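{- Let $M$ be a planar map whose underlying graph contains a subdivision of $K_4$ (as a subgraph). Then $\dim(\mathbf{P}_{VF}(M)) > 3$.
   Context: A planar map $M=(G,D)$ consists of a finite planar multigraph $G$ together with a plane drawing $D$ of $G$; it determines the set $V$ of vertices, the set $E$ of edges, the set $F$ of faces and the incidence relations among them. The vertex-edge-face poset $\mathbf{P}_{VEF}(M)$ is the poset on $V\cup E\cup F$ ordered by inclusion/incidence (a vertex is below each edge of which it is an endpoint and below each face on whose boundary it lies; an edge is below each face on whose boundary it lies). The vertex-face poset $\mathbf{P}_{VF}(M)$ is the subposet of $\mathbf{P}_{VEF}(M)$ induced by $V\cup F$. The dimension $\dim(\mathbf{P})$ of a finite poset $\mathbf{P}$ is the minimum number $t$ of linear orders on its ground set whose intersection is the order of $\mathbf{P}$. -}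

module Defs where

open import Data.Nat using (ℕ; zero; suc; _+_) renaming (_≤_ to _≤ℕ_)
open import Data.Fin using (Fin)
open import Data.Sum using (_⊎_; inj₁; inj₂)
open import Data.Product using (Σ; ∃; _×_; _,_; ∃-syntax; proj₁; proj₂)
open import Data.List using (List; []; _∷_)
open import Data.List.Membership.Propositional using (_∈_)
open import Data.List.Relation.Unary.Unique.Propositional using (Unique)
open import Relation.Binary.PropositionalEquality using (_≡_; _≢_)
open import Relation.Binary.Construct.Closure.ReflexiveTransitive using (Star)
open import Function using (_∘_)
open import Function.Bundles using (_⇔_)
open import Function.Definitions using (Injective)
open import Data.Empty using (⊥)

iter : {A : Set} → (A → A) → ℕ → A → A
iter f zero x = x
iter f (suc k) x = f (iter f k x)

Chain : {A : Set} → (A → A → Set) → A → List A → A → Set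
Chain R a [] b = R a b
Chain R a (x ∷ xs) b = R a x × Chain R x xs b

-- Planar maps, encoded combinatorially.
--
-- Darts (half-edges) Fin nD; α = the fixed-point-free involution pairing
-- the two darts of an edge; σ = rotation around vertices (a permutation).
-- Vertices carrying darts are Fin nV (= σ-orbits), isolated vertices are
-- Fin nI, edges are Fin nE (= α-orbits), boundary walks are Fin nW
-- (= orbits of φ = σ ∘ α). Each boundary walk lies in a face (Fin nF),
-- and each isolated vertex lies in a face.  Connected components of the
-- non-isolated part are Fin nC.  Realisability on the sphere is
-- expressed by: connectedness of the vertex–face incidence graph plus
-- Euler's formula V − E + F = 1 + (#components), i.e.
-- (nV + nI) + nF = 1 + (nC + nI) + nE.

record PlaneMap : Set where
  -- (connectedness of the incidence graph is the separate predicate IsPlane below)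
  field
    nD nV nI nE nW nF nC : ℕ
    α σ σ⁻¹ : Fin nD → Fin nD
    α-invol : ∀ d → α (α d) ≡ d
    α-nofix : ∀ d → α d ≢ d
    σ-invˡ : ∀ d → σ⁻¹ (σ d) ≡ d
    σ-invʳ : ∀ d → σ (σ⁻¹ d) ≡ d
    vert : Fin nD → Fin nV
    vert-surj : ∀ v → ∃[ d ] vert d ≡ v
    vert-orbit : ∀ d d' → (vert d ≡ vert d') ⇔ (∃[ k ] iter σ k d ≡ d')
    edge : Fin nD → Fin nE
    edge-surj : ∀ e → ∃[ d ] edge d ≡ e
    edge-orbit : ∀ d d' → (edge d ≡ edge d') ⇔ (d' ≡ d ⊎ d' ≡ α d)
    walk : Fin nD → Fin nW
    walk-surj : ∀ w → ∃[ d ] walk d ≡ w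
    walk-orbit : ∀ d d' → (walk d ≡ walk d') ⇔ (∃[ k ] iter (σ ∘ α) k d ≡ d')
    faceOfWalk : Fin nW → Fin nF
    faceOfIso : Fin nI → Fin nF
    comp : Fin nV → Fin nC
    comp-surj : ∀ c → ∃[ v ] comp v ≡ c
    comp-edge : ∀ d → comp (vert d) ≡ comp (vert (α d))
    comp-conn : ∀ u v → comp u ≡ comp v →
      Star (λ x y → ∃[ d ] (vert d ≡ x × vert (α d) ≡ y)) u v
    euler : nV + nF ≡ 1 + nC + nE

module _ (M : PlaneMap) where
  open PlaneMap M
  Vtx : Set
  Vtx = Fin nV ⊎ Fin nI

  Adj : Fin nV → Fin nV → Set
  Adj u v = ∃[ d ] (vert d ≡ u × vert (α d) ≡ v)

  Inc : Vtx → Fin nF → Set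
  Inc (inj₁ v) f = ∃[ d ] (vert d ≡ v × faceOfWalk (walk d) ≡ f)
  Inc (inj₂ i) f = faceOfIso i ≡ f

  IncEdge : Vtx ⊎ Fin nF → Vtx ⊎ Fin nF → Set
  IncEdge (inj₁ v) (inj₁ w) = ⊥
  IncEdge (inj₁ v) (inj₂ f) = Inc v f
  IncEdge (inj₂ f) (inj₁ v) = Inc v f
  IncEdge (inj₂ f) (inj₂ g) = ⊥

  IsPlane : Set
  IsPlane = ∀ x y → Star IncEdge x y

open PlaneMap public

_≤VF_ : {M : PlaneMap} → Vtx M ⊎ Fin (nF M) → Vtx M ⊎ Fin (nF M) → Set
_≤VF_ {M} (inj₁ v) (inj₁ w) = v ≡ w
_≤VF_ {M} (inj₁ v) (inj₂ f) = Inc M v f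
_≤VF_ {M} (inj₂ f) (inj₁ v) = ⊥
_≤VF_ {M} (inj₂ f) (inj₂ g) = f ≡ g

PVF : (M : PlaneMap) → Vtx M ⊎ Fin (nF M) → Vtx M ⊎ Fin (nF M) → Set
PVF M = _≤VF_ {M}

-- Dimension: dim(P) ≤ t iff there are t linear orders on the ground set
-- (a linear order on a finite set = an injective ranking into ℕ)
-- whose intersection is the order of P.

DimAtMost : {X : Set} → (X → X → Set) → ℕ → Set
DimAtMost {X} _≤P_ t =
  Σ (Fin t → X → ℕ) λ L → (((i : Fin t) → Injective _≡_ _≡_ (L i)) ×
          (∀ x y → (x ≤P y) ⇔ ((i : Fin t) → L i x ≤ℕ L i y)))

k4ends : Fin 6 → Fin 4 × Fin 4
k4ends Fin.zero = (Fin.zero , Fin.suc Fin.zero)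
k4ends (Fin.suc Fin.zero) = (Fin.zero , Fin.suc (Fin.suc Fin.zero))
k4ends (Fin.suc (Fin.suc Fin.zero)) = (Fin.zero , Fin.suc (Fin.suc (Fin.suc Fin.zero)))
k4ends (Fin.suc (Fin.suc (Fin.suc Fin.zero))) = (Fin.suc Fin.zero , Fin.suc (Fin.suc Fin.zero))
k4ends (Fin.suc (Fin.suc (Fin.suc (Fin.suc Fin.zero)))) = (Fin.suc Fin.zero , Fin.suc (Fin.suc (Fin.suc Fin.zero)))
k4ends (Fin.suc (Fin.suc (Fin.suc (Fin.suc (Fin.suc Fin.zero))))) = (Fin.suc (Fin.suc Fin.zero) , Fin.suc (Fin.suc (Fin.suc Fin.zero)))

record K4Subdivision (M : PlaneMap) : Set where
  field
    branch : Fin 4 → Fin (nV M)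
    branch-inj : Injective _≡_ _≡_ branch
    inner : Fin 6 → List (Fin (nV M))
    is-path : ∀ k → Chain (Adj M) (branch (proj₁ (k4ends k))) (inner k) (branch (proj₂ (k4ends k)))
    inner-unique : ∀ k → Unique (inner k)
    inner-not-branch : ∀ k x i → x ∈ inner k → x ≢ branch i
    inner-disjoint : ∀ k l x → x ∈ inner k → x ∈ inner l → k ≡ l

{-# OPTIONS --safe #-}

-- All chains are taken modulo 2.  Let three linear orders realize the vertex-face poset.  A vertex
-- off a face lies above all vertices of that face in one of the orders.  Draw the graph in the plane
-- with the second and third order as coordinates and L-shaped edges.  Separation in one of the orders
-- shows that this drawing, although not an embedding, winds an even number of times around v along
-- the boundary of each face not containing v, and that two edges cross an even number of times if
-- each end of either is separated from the other edge.
--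
-- For a branch vertex x of the K₄-subdivision, the opposite triangle of paths bounds a set of faces
-- (by Euler's formula the first homology vanishes) that can be chosen to avoid x; hence the drawing of
-- the triangle winds evenly around x.  A vertex on the path opposite to an edge e of the subdivision is
-- not on both faces at e, so opposite paths cross evenly.  But in any drawing of K₄ the winding numbers
-- of the triangles around the opposite vertices and the crossings of opposite edges add up to an odd
-- number (the topological Radon theorem in the plane).
module Submission where

open import Algebra.Bundles using (CommutativeRing)
import Algebra.Properties.Semiring.Sum as SemiringSum
open import Data.Bool using (Bool; true; false; not; _∧_; _∨_; _xor_; if_then_else_)
open import Data.Bool.Properties using (xor-∧-commutativeRing; xor-same; xor-comm; xor-assoc; xor-identityʳ; ∧-comm; ∧-assoc; ∧-zeroʳ; ∧-identityʳ; ∧-distribˡ-xor; ∧-distribʳ-xor; ∨-zeroʳ; not-injective) renaming (_≟_ to _≟ᵇ_)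
open import Data.Bool.Solver using (module xor-∧-Solver)
open import Data.Empty using (⊥)
open import Data.Fin using (Fin; zero; suc; punchIn; punchOut; funToFin; finToFun; combine; splitAt; join; opposite)
open import Data.Fin.Patterns using (0F; 1F; 2F; 3F; 4F; 5F)
open import Data.Fin.Permutation using (Permutation; permutation; _⟨$⟩ʳ_)
open import Data.Fin.Properties using (_≟_; any?; all?; ¬∀⟶∃¬; pigeonhole; punchInᵢ≢i; punchIn-punchOut; funToFin-finToFin; finToFun-funToFin; 2↔Bool; splitAt-join) renaming (<⇒≢ to <⇒≢ᶠ)
open import Data.List using (List; []; _∷_)
open import Data.List.Membership.Propositional using (_∈_)
open import Data.List.Relation.Unary.Any using (here; there)
open import Data.Nat using (ℕ; zero; suc; _+_; _<_; _≤_; _^_; _<?_; _≤?_; s≤s; z≤n; s<s⁻¹)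
open import Data.Nat.Properties using (^-monoʳ-<; +-suc; +-identityʳ; +-comm; ≤-reflexive; <⇒≤; <⇒≢; <-≤-trans; ≤-<-trans; <-irrefl; ≰⇒>; ≮⇒≥; ≤∧≢⇒<)
open import Data.Product using (∃; _×_; _,_; proj₁; proj₂)
open import Data.Sum using (_⊎_; inj₁; inj₂; map₁)
open import Data.Sum.Properties using (inj₁-injective)
open import Data.Vec using (Vec; []; _∷_)
open import Defs using (iter; Chain; PlaneMap; Vtx; Adj; Inc; IncEdge; IsPlane; PVF; DimAtMost; k4ends; K4Subdivision)
open import Function using (_∘_)
open import Function.Bundles using (Equivalence; Inverse; _⇔_)
open import Function.Definitions using (Injective)
open import Relation.Binary.Construct.Closure.ReflexiveTransitive using (Star; ε; _◅_)
open import Relation.Binary.PropositionalEquality using (_≡_; _≢_; _≗_; refl; sym; trans; cong; cong₂; subst; module ≡-Reasoning)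
open import Relation.Nullary using (¬_; yes; no; contradiction; ⌊_⌋)
open import Relation.Nullary.Decidable using (from-yes; _→-dec_; _⊎-dec_)

-- Finite sums modulo 2.

private module Sum = SemiringSum (CommutativeRing.semiring xor-∧-commutativeRing)

-- Opaque, so that summands are inferred by unification.
opaque
  ∑ : ∀ {n} → (Fin n → Bool) → Bool
  ∑ = Sum.sum

  ∑-suc : ∀ {n} (f : Fin (suc n) → Bool) → ∑ f ≡ f zero xor ∑ (f ∘ suc)
  ∑-suc f = refl

  ∑-cong : ∀ {n} {f g : Fin n → Bool} → f ≗ g → ∑ f ≡ ∑ g
  ∑-cong = Sum.sum-cong-≗

  ∑-false : ∀ {n} {f : Fin n → Bool} → (∀ i → f i ≡ false) → ∑ f ≡ false
  ∑-false {n} f≡0 = trans (Sum.sum-cong-≗ f≡0) (Sum.sum-replicate-zero n)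

  ∑-remove : ∀ {n} (i : Fin (suc n)) (f : Fin (suc n) → Bool) → ∑ f ≡ f i xor ∑ (f ∘ punchIn i)
  ∑-remove i f = Sum.sum-remove {i = i} f

  ∑-xor : ∀ {n} {f g : Fin n → Bool} → ∑ (λ i → f i xor g i) ≡ ∑ f xor ∑ g
  ∑-xor {f = f} {g} = Sum.∑-distrib-+ f g

  ∑-comm : ∀ {m n} (f : Fin m → Fin n → Bool) → ∑ (λ i → ∑ (f i)) ≡ ∑ (λ j → ∑ (λ i → f i j))
  ∑-comm = Sum.∑-comm

  ∧-distribˡ-∑ : ∀ {n} b (f : Fin n → Bool) → b ∧ ∑ f ≡ ∑ (λ i → b ∧ f i)
  ∧-distribˡ-∑ = Sum.*-distribˡ-sum

  ∧-distribʳ-∑ : ∀ {n} b (f : Fin n → Bool) → ∑ f ∧ b ≡ ∑ (λ i → f i ∧ b)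
  ∧-distribʳ-∑ = Sum.*-distribʳ-sum

  ∑-permute : ∀ {n} (f : Fin n → Bool) (π : Permutation n n) → ∑ f ≡ ∑ (λ i → f (π ⟨$⟩ʳ i))
  ∑-permute = Sum.sum-permute

xor-false⇒≡ : ∀ {a b} → a xor b ≡ false → a ≡ b
xor-false⇒≡ {false} {false} _ = refl
xor-false⇒≡ {true} {true} _ = refl

∑-single : ∀ {n} (j : Fin n) {f : Fin n → Bool} → (∀ i → i ≢ j → f i ≡ false) → ∑ f ≡ f j
∑-single {suc n} j {f} f≡0 = begin
  ∑ f                          ≡⟨ ∑-remove j f ⟩
  f j xor ∑ (f ∘ punchIn j)    ≡⟨ cong (f j xor_) (∑-false (λ i → f≡0 (punchIn j i) (punchInᵢ≢i j i))) ⟩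
  f j xor false                ≡⟨ xor-identityʳ (f j) ⟩
  f j                          ∎
  where open ≡-Reasoning

δ : ∀ {n} → Fin n → Fin n → Bool
δ i j = ⌊ i ≟ j ⌋

δ-refl : ∀ {n} (i : Fin n) → δ i i ≡ true
δ-refl i with i ≟ i
... | yes _ = refl
... | no i≢i = contradiction refl i≢i

δ-≢ : ∀ {n} {i j : Fin n} → i ≢ j → δ i j ≡ false
δ-≢ {i = i} {j} i≢j with i ≟ j
... | yes i≡j = contradiction i≡j i≢j
... | no _ = refl

δ-true : ∀ {n} {i j : Fin n} → δ i j ≡ true → i ≡ j
δ-true {i = i} {j} eq with i ≟ j
... | yes i≡j = i≡j

∑-δ : ∀ {n} (j : Fin n) (f : Fin n → Bool) → ∑ (λ i → δ i j ∧ f i) ≡ f j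
∑-δ j f = trans (∑-single j (λ i i≢j → cong (_∧ f i) (δ-≢ i≢j))) (cong (_∧ f j) (δ-refl j))

-- Linear algebra over the two-element field.

infix 8 _∙_

_∙_ : ∀ {n} → (Fin n → Bool) → (Fin n → Bool) → Bool
u ∙ v = ∑ (λ i → u i ∧ v i)

∙-distribˡ-xor : ∀ {n} (u v w : Fin n → Bool) → u ∙ (λ i → v i xor w i) ≡ u ∙ v xor u ∙ w
∙-distribˡ-xor u v w = trans (∑-cong λ i → ∧-distribˡ-xor (u i) (v i) (w i)) ∑-xor

∙-distribʳ-xor : ∀ {n} (u v w : Fin n → Bool) → (λ i → u i xor v i) ∙ w ≡ u ∙ w xor v ∙ w
∙-distribʳ-xor u v w = trans (∑-cong λ i → ∧-distribʳ-xor (w i) (u i) (v i)) ∑-xor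

∙-scaleˡ : ∀ {n} b (u v : Fin n → Bool) → (λ i → b ∧ u i) ∙ v ≡ b ∧ u ∙ v
∙-scaleˡ b u v = trans (∑-cong λ i → ∧-assoc b (u i) (v i)) (sym (∧-distribˡ-∑ b _))

-- Associativity of the product of a row vector, a matrix and a column vector.
∙-swap : ∀ {m n} (u : Fin m → Bool) (A : Fin m → Fin n → Bool) (v : Fin n → Bool) →
         u ∙ (λ i → A i ∙ v) ≡ (λ j → u ∙ (λ i → A i j)) ∙ v
∙-swap u A v = begin
  u ∙ (λ i → A i ∙ v)                       ≡⟨ ∑-cong (λ i → ∧-distribˡ-∑ (u i) _) ⟩
  ∑ (λ i → ∑ (λ j → u i ∧ (A i j ∧ v j)))   ≡⟨ ∑-comm _ ⟩
  ∑ (λ j → ∑ (λ i → u i ∧ (A i j ∧ v j)))   ≡⟨ ∑-cong (λ j → ∑-cong (λ i → ∧-assoc (u i) (A i j) (v j))) ⟨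
  ∑ (λ j → ∑ (λ i → (u i ∧ A i j) ∧ v j))   ≡⟨ ∑-cong (λ j → ∧-distribʳ-∑ (v j) _) ⟨
  (λ j → u ∙ (λ i → A i j)) ∙ v             ∎
  where open ≡-Reasoning

-- Pigeonhole on the 2ⁿ vectors: two of them have the same image, and their sum is in the kernel.
wide-kernel : ∀ {m n} → m < n → (A : Fin m → Fin n → Bool) →
  ∃ λ x → (∃ λ j → x j ≡ true) × (∀ i → A i ∙ x ≡ false)
wide-kernel {m} {n} m<n A = x , nonzero , kernel
  where
  open Inverse 2↔Bool using (to; from; strictlyInverseˡ; strictlyInverseʳ)
  vec : Fin (2 ^ n) → Fin n → Bool
  vec k j = to (finToFun k j)
  image : Fin (2 ^ n) → Fin m → Fin 2
  image k i = from (A i ∙ vec k)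
  collision = pigeonhole (^-monoʳ-< 2 (s≤s (s≤s z≤n)) m<n) (funToFin ∘ image)
  k = proj₁ collision
  l = proj₁ (proj₂ collision)
  x : Fin n → Bool
  x j = vec k j xor vec l j
  funToFin-cong : ∀ {p q} {f g : Fin p → Fin q} → f ≗ g → funToFin f ≡ funToFin g
  funToFin-cong {zero} f≗g = refl
  funToFin-cong {suc p} f≗g = cong₂ combine (f≗g zero) (funToFin-cong (f≗g ∘ suc))
  to-injective : ∀ {a b} → to a ≡ to b → a ≡ b
  to-injective {a} {b} eq = trans (sym (strictlyInverseʳ a)) (trans (cong from eq) (strictlyInverseʳ b))
  nonzero : ∃ λ j → x j ≡ true
  nonzero with any? (λ j → x j ≟ᵇ true)
  ... | yes p = p
  ... | no ¬p = contradiction k≡l (<⇒≢ᶠ (proj₁ (proj₂ (proj₂ collision))))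
    where
    x≡0 : ∀ j → x j ≡ false
    x≡0 j with x j in eq
    ... | false = refl
    ... | true = contradiction (j , eq) ¬p
    k≡l : k ≡ l
    k≡l = begin
      k                    ≡⟨ funToFin-finToFin {n} {2} k ⟨
      funToFin {n} (finToFun k)  ≡⟨ funToFin-cong (λ j → to-injective (xor-false⇒≡ (x≡0 j))) ⟩
      funToFin {n} (finToFun l)  ≡⟨ funToFin-finToFin {n} {2} l ⟩
      l                    ∎
      where open ≡-Reasoning
  same-image : ∀ i → A i ∙ vec k ≡ A i ∙ vec l
  same-image i = begin
    A i ∙ vec k       ≡⟨ strictlyInverseˡ _ ⟨
    to (image k i)    ≡⟨ cong to (finToFun-funToFin (image k) i) ⟨
    to (finToFun (funToFin (image k)) i)  ≡⟨ cong (λ z → to (finToFun z i)) (proj₂ (proj₂ (proj₂ collision))) ⟩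
    to (finToFun (funToFin (image l)) i)  ≡⟨ cong to (finToFun-funToFin (image l) i) ⟩
    to (image l i)    ≡⟨ strictlyInverseˡ _ ⟩
    A i ∙ vec l       ∎
    where open ≡-Reasoning
  kernel : ∀ i → A i ∙ x ≡ false
  kernel i = begin
    A i ∙ x                       ≡⟨ ∙-distribˡ-xor (A i) (vec k) (vec l) ⟩
    A i ∙ vec k xor A i ∙ vec l   ≡⟨ cong (_xor A i ∙ vec l) (same-image i) ⟩
    A i ∙ vec l xor A i ∙ vec l   ≡⟨ xor-same (A i ∙ vec l) ⟩
    false                         ∎
    where open ≡-Reasoning

Independent : ∀ {k m} → (Fin k → Fin m → Bool) → Set
Independent B = ∀ y → (∀ j → y ∙ (λ i → B i j) ≡ false) → ∀ i → y i ≡ false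

-- The columns of A lie in the kernel of B, which has dimension m − k.
annihilated-kernel : ∀ {k m n} → m < n + k →
  (B : Fin k → Fin m → Bool) → Independent B →
  (A : Fin m → Fin n → Bool) → (∀ i c → B i ∙ (λ j → A j c) ≡ false) →
  ∃ λ x → (∃ λ c → x c ≡ true) × (∀ j → A j ∙ x ≡ false)
annihilated-kernel {zero} {n = n} m<n+0 B _ A _ = wide-kernel (subst (_ <_) (+-identityʳ n) m<n+0) A
annihilated-kernel {suc k} {m} {n} m<n+k B indep A BA≡0 with any? (λ e → B zero e ≟ᵇ true)
-- Without a pivot the first row of `B` vanishes, and the unit vector `δ zero` contradicts
-- independence.
... | no ¬pivot = contradiction (indep (δ zero) row₀≡0 zero) λ ()
  where
  row₀≡0 : ∀ j → δ zero ∙ (λ i → B i j) ≡ false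
  row₀≡0 j = trans (∑-single zero λ { zero i≢0 → contradiction refl i≢0 ; (suc i) _ → refl })
                   (B₀≡0 j)
    where
    B₀≡0 : ∀ j → B zero j ≡ false
    B₀≡0 j with B zero j in eq
    ... | false = refl
    ... | true = contradiction (j , eq) ¬pivot
annihilated-kernel {suc k} {suc m} {n} m<n+k B indep A BA≡0 | yes (e , B₀e≡1) =
  x , nonzero , kernel
  where
  open ≡-Reasoning
  A′ : Fin m → Fin n → Bool
  A′ j = A (punchIn e j)
  -- Gaussian elimination: multiples of row zero clear column `e` in the other rows; then row zero
  -- and column `e` are deleted.
  B′ : Fin k → Fin m → Bool
  B′ i j = B (suc i) (punchIn e j) xor B (suc i) e ∧ B zero (punchIn e j)
  indep′ : Independent B′
  indep′ y yB′≡0 i = indep Y YB≡0 (suc i)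
    where
    -- The coefficient of row zero when the combination `y` of reduced rows is expanded in the rows
    -- of `B`.
    c = y ∙ (λ i → B (suc i) e)
    Y : Fin (suc k) → Bool
    Y zero = c
    Y (suc i) = y i
    YB≡0 : ∀ j → Y ∙ (λ i → B i j) ≡ false
    YB≡0 j with e ≟ j
    ... | yes refl = trans (∑-suc _) (trans (cong (λ b → c ∧ b xor c) B₀e≡1) (c∧1+c c))
      where
      c∧1+c : ∀ c → c ∧ true xor c ≡ false
      c∧1+c false = refl
      c∧1+c true = refl
    ... | no e≢j = subst (λ j → Y ∙ (λ i → B i j) ≡ false) (punchIn-punchOut e≢j) (begin
      Y ∙ (λ i → B i j′)
        ≡⟨ ∑-suc _ ⟩
      c ∧ b₀ xor y ∙ (λ i → B (suc i) j′)
        ≡⟨ xor-comm (c ∧ b₀) _ ⟩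
      y ∙ (λ i → B (suc i) j′) xor c ∧ b₀
        ≡⟨ cong (y ∙ (λ i → B (suc i) j′) xor_) (∧-distribʳ-∑ b₀ _) ⟩
      y ∙ (λ i → B (suc i) j′) xor ∑ (λ i → (y i ∧ B (suc i) e) ∧ b₀)
        ≡⟨ cong (y ∙ (λ i → B (suc i) j′) xor_) (∑-cong λ i → ∧-assoc (y i) (B (suc i) e) b₀) ⟩
      y ∙ (λ i → B (suc i) j′) xor y ∙ (λ i → B (suc i) e ∧ b₀)
        ≡⟨ ∙-distribˡ-xor y _ _ ⟨
      y ∙ (λ i → B′ i (punchOut e≢j))
        ≡⟨ yB′≡0 (punchOut e≢j) ⟩
      false ∎)
      where
      j′ = punchIn e (punchOut e≢j)
      b₀ = B zero j′
  BA-split : ∀ i (v : Fin (suc m) → Bool) →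
    B i ∙ v ≡ B i e ∧ v e xor (B i ∘ punchIn e) ∙ (v ∘ punchIn e)
  BA-split i v = ∑-remove e _
  B′A′≡0 : ∀ i c → B′ i ∙ (λ j → A′ j c) ≡ false
  B′A′≡0 i c = begin
    B′ i ∙ a
      ≡⟨ ∙-distribʳ-xor (B (suc i) ∘ punchIn e) (λ j → B (suc i) e ∧ B zero (punchIn e j)) a ⟩
    p xor (λ j → B (suc i) e ∧ B zero (punchIn e j)) ∙ a
      ≡⟨ cong (p xor_) (∙-scaleˡ (B (suc i) e) (B zero ∘ punchIn e) a) ⟩
    p xor B (suc i) e ∧ q
      ≡⟨ cong (λ z → p xor B (suc i) e ∧ z) (sym row₀) ⟩
    p xor B (suc i) e ∧ A e c
      ≡⟨ xor-comm p _ ⟩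
    B (suc i) e ∧ A e c xor p
      ≡⟨ BA-split (suc i) (λ j → A j c) ⟨
    B (suc i) ∙ (λ j → A j c)
      ≡⟨ BA≡0 (suc i) c ⟩
    false ∎
    where
    a = λ j → A′ j c
    p = (B (suc i) ∘ punchIn e) ∙ a
    q = (B zero ∘ punchIn e) ∙ a
    row₀ : A e c ≡ q
    row₀ = xor-false⇒≡ (begin
      A e c xor q               ≡⟨ cong (λ b → b ∧ A e c xor q) B₀e≡1 ⟨
      B zero e ∧ A e c xor q    ≡⟨ BA-split zero (λ j → A j c) ⟨
      B zero ∙ (λ j → A j c)    ≡⟨ BA≡0 zero c ⟩
      false                     ∎)
  rec = annihilated-kernel (s<s⁻¹ (subst (suc m <_) (+-suc n k) m<n+k)) B′ indep′ A′ B′A′≡0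
  x = proj₁ rec
  nonzero = proj₁ (proj₂ rec)
  kernel′ = proj₂ (proj₂ rec)
  -- Row zero of `B`, having a nonzero entry at `e`, expresses row `e` of `A` through the other
  -- rows, and those already annihilate `x`.
  Aₑx≡0 : A e ∙ x ≡ false
  Aₑx≡0 = begin
    A e ∙ x
      ≡⟨ xor-identityʳ _ ⟨
    A e ∙ x xor false
      ≡⟨ cong₂ (λ b z → b ∧ A e ∙ x xor z) B₀e≡1 (∑-false λ j → trans (cong (B zero (punchIn e j) ∧_) (kernel′ j)) (∧-zeroʳ _)) ⟨
    B zero e ∧ A e ∙ x xor (B zero ∘ punchIn e) ∙ (λ j → A′ j ∙ x)
      ≡⟨ BA-split zero (λ j → A j ∙ x) ⟨
    B zero ∙ (λ j → A j ∙ x)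
      ≡⟨ ∙-swap (B zero) A x ⟩
    (λ c → B zero ∙ (λ j → A j c)) ∙ x
      ≡⟨ ∑-false (λ c → cong (_∧ x c) (BA≡0 zero c)) ⟩
    false ∎
  kernel : ∀ j → A j ∙ x ≡ false
  kernel j with e ≟ j
  ... | yes refl = Aₑx≡0
  ... | no e≢j = subst (λ j → A j ∙ x ≡ false) (punchIn-punchOut e≢j) (kernel′ (punchOut e≢j))

∑-splitAt : ∀ m {n} (h : Fin m ⊎ Fin n → Bool) → ∑ (h ∘ splitAt m) ≡ ∑ (h ∘ inj₁) xor ∑ (h ∘ inj₂)
∑-splitAt zero h = cong (_xor ∑ (h ∘ inj₂)) (sym (∑-false {f = h ∘ inj₁} λ ()))
∑-splitAt (suc m) h = begin
  ∑ (h ∘ splitAt (suc m))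
    ≡⟨ ∑-suc _ ⟩
  h₀ xor ∑ (h′ ∘ splitAt m)
    ≡⟨ cong (h₀ xor_) (∑-splitAt m h′) ⟩
  h₀ xor (∑ (h′ ∘ inj₁) xor ∑ (h ∘ inj₂))
    ≡⟨ xor-assoc h₀ _ _ ⟨
  (h₀ xor ∑ (h′ ∘ inj₁)) xor ∑ (h ∘ inj₂)
    ≡⟨ cong (_xor ∑ (h ∘ inj₂)) (∑-suc _) ⟨
  ∑ (h ∘ inj₁) xor ∑ (h ∘ inj₂) ∎
  where
  open ≡-Reasoning
  h₀ = h (inj₁ zero)
  h′ : Fin m ⊎ Fin _ → Bool
  h′ = h ∘ map₁ suc

-- Homology of a plane map modulo 2.

module PlaneHomology (M : PlaneMap) (plane : IsPlane M) where
  open PlaneMap M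
  open ≡-Reasoning

  face : Fin nD → Fin nF
  face d = faceOfWalk (walk d)

  vert-σ : ∀ d → vert (σ d) ≡ vert d
  vert-σ d = sym (Equivalence.from (vert-orbit d (σ d)) (1 , refl))

  face-φ : ∀ d → face (σ (α d)) ≡ face d
  face-φ d = sym (cong faceOfWalk (Equivalence.from (walk-orbit d (σ (α d))) (1 , refl)))

  -- As `α` is an involution, `σ d` follows `α d` on its boundary walk. So a rotation step at a
  -- vertex passes from one side of the edge of `d` to the other.
  face-σ : ∀ d → face (σ d) ≡ face (α d)
  face-σ d = subst (λ d′ → face (σ d′) ≡ face (α d)) (α-invol d) (face-φ (α d))

  ∑-σ : ∀ f → ∑ (f ∘ σ) ≡ ∑ f
  ∑-σ f = sym (∑-permute f (permutation σ σ⁻¹ σ-invʳ σ-invˡ))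

  ∑-α : ∀ f → ∑ (f ∘ α) ≡ ∑ f
  ∑-α f = sym (∑-permute f (permutation α α α-invol α-invol))

  -- An arbitrary orientation of the edges, through which functions on darts become functions on
  -- edges.
  dart : Fin nE → Fin nD
  dart e = proj₁ (edge-surj e)

  edge-dart : ∀ e → edge (dart e) ≡ e
  edge-dart e = proj₂ (edge-surj e)

  edge-α : ∀ d → edge (α d) ≡ edge d
  edge-α d = sym (Equivalence.from (edge-orbit d (α d)) (inj₂ refl))

  same-edge : ∀ {d d′} → edge d ≡ edge d′ → d′ ≡ d ⊎ d′ ≡ α d
  same-edge {d} {d′} = Equivalence.to (edge-orbit d d′)

  dart-edge : (H : Fin nD → Bool) → (∀ d → H (α d) ≡ H d) → ∀ d → H (dart (edge d)) ≡ H d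
  dart-edge H H-α d with same-edge {dart (edge d)} {d} (edge-dart (edge d))
  ... | inj₁ eq = cong H (sym eq)
  ... | inj₂ eq = trans (sym (H-α _)) (cong H (sym eq))

  δ-edge : ∀ e d → δ e (edge d) ≡ δ d (dart e) xor δ d (α (dart e))
  δ-edge e d with e ≟ edge d
  ... | no e≢ = sym (cong₂ _xor_ (δ-≢ {i = d} {dart e} (λ { refl → e≢ (sym (edge-dart e)) }))
                                 (δ-≢ {i = d} {α (dart e)} (λ { refl → e≢ (sym (trans (edge-α _) (edge-dart e))) })))
  ... | yes e≡ with same-edge {dart e} {d} (trans (edge-dart e) e≡)
  ...   | inj₁ refl = sym (cong₂ _xor_ (δ-refl d) (δ-≢ (α-nofix d ∘ sym)))
  ...   | inj₂ refl = sym (cong₂ _xor_ (δ-≢ (α-nofix (dart e))) (δ-refl d))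

  ∑-darts : ∀ G → ∑ G ≡ ∑ (λ e → G (dart e) xor G (α (dart e)))
  ∑-darts G = begin
    ∑ G
      ≡⟨ ∑-cong (λ d → ∑-δ (edge d) (λ _ → G d)) ⟨
    ∑ (λ d → ∑ (λ e → δ e (edge d) ∧ G d))
      ≡⟨ ∑-comm _ ⟩
    ∑ (λ e → ∑ (λ d → δ e (edge d) ∧ G d))
      ≡⟨ ∑-cong (λ e → ∑-cong λ d → cong (_∧ G d) (δ-edge e d)) ⟩
    ∑ (λ e → (λ d → δ d (dart e) xor δ d (α (dart e))) ∙ G)
      ≡⟨ ∑-cong (λ e → trans (∙-distribʳ-xor (λ d → δ d (dart e)) (λ d → δ d (α (dart e))) G)
                             (cong₂ _xor_ (∑-δ (dart e) G) (∑-δ (α (dart e)) G))) ⟩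
    ∑ (λ e → G (dart e) xor G (α (dart e))) ∎

  -- `∂₁` and `∂₂` are the entries of the boundary matrices modulo 2; they vanish at loops and at
  -- edges with the same face on both sides, respectively.
  ∂₁ : Fin nV → Fin nD → Bool
  ∂₁ v d = δ v (vert d) xor δ v (vert (α d))

  ∂₂ : Fin nF → Fin nD → Bool
  ∂₂ f d = δ f (face d) xor δ f (face (α d))

  swap-α : ∀ {A : Set} (h : A → Bool) (k : Fin nD → A) d →
    h (k (α d)) xor h (k (α (α d))) ≡ h (k d) xor h (k (α d))
  swap-α h k d = trans (cong (λ d′ → h (k (α d)) xor h (k d′)) (α-invol d)) (xor-comm (h (k (α d))) _)

  -- Each dart at `v` contributes the two corners next to it, so in a full rotation around `v` every
  -- corner is counted twice.
  ∂₁∂₂≡0 : ∀ v f → (λ e → ∂₁ v (dart e)) ∙ (λ e → ∂₂ f (dart e)) ≡ false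
  ∂₁∂₂≡0 v f = begin
    (λ e → ∂₁ v (dart e)) ∙ (λ e → ∂₂ f (dart e))
      ≡⟨ ∑-cong (λ e → trans (∧-distribʳ-xor (∂₂ f (dart e)) (δ v (vert (dart e))) (δ v (vert (α (dart e)))))
                             (cong (λ b → G (dart e) xor δ v (vert (α (dart e))) ∧ b) (sym (swap-α (δ f) face (dart e))))) ⟩
    ∑ (λ e → G (dart e) xor G (α (dart e)))
      ≡⟨ ∑-darts G ⟨
    ∑ G
      ≡⟨ ∑-cong (λ d → trans (∧-distribˡ-xor (δ v (vert d)) (δ f (face d)) (δ f (face (α d))))
                             (cong (K d xor_) (sym (cong₂ (λ w g → δ v w ∧ δ f g) (vert-σ d) (face-σ d))))) ⟩
    ∑ (λ d → K d xor K (σ d))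
      ≡⟨ ∑-xor ⟩
    ∑ K xor ∑ (K ∘ σ)
      ≡⟨ cong (∑ K xor_) (∑-σ K) ⟩
    ∑ K xor ∑ K
      ≡⟨ xor-same (∑ K) ⟩
    false ∎
    where
    G K : Fin nD → Bool
    G d = δ v (vert d) ∧ ∂₂ f d
    K d = δ v (vert d) ∧ δ f (face d)

  Bounds : (Fin nF → Bool) → (Fin nE → Bool) → Set
  Bounds g z = ∀ d → g (face d) xor g (face (α d)) ≡ z (edge d)

  Avoids : (Fin nE → Bool) → Fin nV → Set
  Avoids z v = ∀ d → vert d ≡ v → z (edge d) ≡ false

  -- Rotating around `v` only crosses edges outside `z`, and `g` agrees on both sides of such an
  -- edge.
  constant-around : ∀ {g z v} → Bounds g z → Avoids z v →
    ∀ d d′ → vert d ≡ v → vert d′ ≡ v → g (face d) ≡ g (face d′)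
  constant-around {g} {z} {v} ∂g≡z z≢v d d′ vd≡v vd′≡v =
    trans (sym (proj₂ (along (proj₁ orbit)))) (cong (g ∘ face) (proj₂ orbit))
    where
    orbit = Equivalence.to (vert-orbit d d′) (trans vd≡v (sym vd′≡v))
    along : ∀ k → vert (iter σ k d) ≡ v × g (face (iter σ k d)) ≡ g (face d)
    along zero = vd≡v , refl
    along (suc k) = trans (vert-σ d″) (proj₁ ih) , (begin
      g (face (σ d″))   ≡⟨ cong g (face-σ d″) ⟩
      g (face (α d″))   ≡⟨ xor-false⇒≡ (trans (∂g≡z d″) (z≢v d″ (proj₁ ih))) ⟨
      g (face d″)       ≡⟨ proj₂ ih ⟩
      g (face d)        ∎)
      where
      d″ = iter σ k d
      ih = along k

  -- Without boundary, `g` takes a single value on the faces around each vertex; connectedness of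
  -- the incidence graph spreads this value to all faces.
  closed-constant : ∀ {g} → Bounds g (λ _ → false) → ∀ f f′ → g f ≡ g f′
  closed-constant {g} ∂g≡0 f f′ = sym (transport (plane (inj₂ f) (inj₂ f′)) refl)
    where
    Value : Vtx M ⊎ Fin nF → Set
    Value (inj₁ v) = ∀ f″ → Inc M v f″ → g f″ ≡ g f
    Value (inj₂ f″) = g f″ ≡ g f
    spread : ∀ v f₁ f₂ → Inc M v f₁ → Inc M v f₂ → g f₁ ≡ g f₂
    spread (inj₁ v) _ _ (d₁ , vd₁≡v , refl) (d₂ , vd₂≡v , refl) =
      constant-around {g} {λ _ → false} ∂g≡0 (λ _ _ → refl) d₁ d₂ vd₁≡v vd₂≡v
    spread (inj₂ i) _ _ refl refl = refl
    step : ∀ x y → IncEdge M x y → Value x → Value y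
    step (inj₁ v) (inj₂ f₁) v∈f₁ val = val f₁ v∈f₁
    step (inj₂ f₁) (inj₁ v) v∈f₁ val f₂ v∈f₂ = trans (spread v f₂ f₁ v∈f₂ v∈f₁) val
    transport : ∀ {x y} → Star (IncEdge M) x y → Value x → Value y
    transport ε val = val
    transport (s ◅ ss) val = transport ss (step _ _ s val)

  -- Euler's formula leaves no room for a cycle that is not a boundary: otherwise the boundaries
  -- of all faces but f₀ together with z would be nF independent elements of the cycle space.
  -- The nC extra columns of the incidence matrix (one root per component) make its rows independent.
  cycle-bounds : (z : Fin nE → Bool) → (∀ v → (λ e → ∂₁ v (dart e)) ∙ z ≡ false) → Fin nF →
    ∃ λ g → Bounds g z
  cycle-bounds z ∂z≡0 f₀ = g , g-bounds
    where
    root : Fin nC → Fin nV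
    root c = proj₁ (comp-surj c)
    B₀ : Fin nV → Fin nC ⊎ Fin nE → Bool
    B₀ v (inj₁ c) = δ v (root c)
    B₀ v (inj₂ e) = ∂₁ v (dart e)
    A₁ : Fin nE → Fin nF → Bool
    A₁ e f = if δ f f₀ then z e else ∂₂ f (dart e)
    A₀ : Fin nC ⊎ Fin nE → Fin nF → Bool
    A₀ (inj₁ c) f = false
    A₀ (inj₂ e) f = A₁ e f
    B : Fin nV → Fin (nC + nE) → Bool
    B v j = B₀ v (splitAt nC j)
    A : Fin (nC + nE) → Fin nF → Bool
    A j = A₀ (splitAt nC j)
    -- By Euler's formula the two sides differ by exactly one.
    size : nC + nE < nF + nV
    size = ≤-reflexive (trans (sym euler) (+-comm nV nF))
    -- A relation `y` between the rows agrees at the two ends of every edge, hence is constant on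
    -- components, and the root columns make it zero there.
    B-indep : Independent B
    B-indep y yB≡0 v = trans (y-const (comp-conn v (root (comp v)) (sym (proj₂ (comp-surj (comp v)))))) (y-root (comp v))
      where
      yB₀≡0 : ∀ s → y ∙ (λ v → B₀ v s) ≡ false
      yB₀≡0 s = subst (λ s → y ∙ (λ v → B₀ v s) ≡ false) (splitAt-join nC nE s) (yB≡0 (join nC nE s))
      y∙δ : ∀ w → y ∙ (λ v → δ v w) ≡ y w
      y∙δ w = trans (∑-cong λ v → ∧-comm (y v) (δ v w)) (∑-δ w y)
      y-root : ∀ c → y (root c) ≡ false
      y-root c = trans (sym (y∙δ (root c))) (yB₀≡0 (inj₁ c))
      y-edge : ∀ d → y (vert d) xor y (vert (α d)) ≡ false
      y-edge d = begin
        H d                                        ≡⟨ dart-edge H (swap-α y vert) d ⟨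
        H d′                                       ≡⟨ cong₂ _xor_ (y∙δ (vert d′)) (y∙δ (vert (α d′))) ⟨
        _                                          ≡⟨ ∙-distribˡ-xor y (λ v → δ v (vert d′)) (λ v → δ v (vert (α d′))) ⟨
        y ∙ (λ v → ∂₁ v d′)                        ≡⟨ yB₀≡0 (inj₂ (edge d)) ⟩
        false                                      ∎
        where
        H : Fin nD → Bool
        H d = y (vert d) xor y (vert (α d))
        d′ = dart (edge d)
      y-const : ∀ {u w} → Star (Adj M) u w → y u ≡ y w
      y-const ε = refl
      y-const ((d , refl , refl) ◅ path) = trans (xor-false⇒≡ (y-edge d)) (y-const path)
    BA≡0 : ∀ v f → B v ∙ (λ j → A j f) ≡ false
    BA≡0 v f = begin
      B v ∙ (λ j → A j f)
        ≡⟨ ∑-splitAt nC (λ s → B₀ v s ∧ A₀ s f) ⟩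
      ∑ (λ c → B₀ v (inj₁ c) ∧ false) xor (λ e → ∂₁ v (dart e)) ∙ (λ e → A₁ e f)
        ≡⟨ cong (_xor (λ e → ∂₁ v (dart e)) ∙ (λ e → A₁ e f)) (∑-false λ c → ∧-zeroʳ (B₀ v (inj₁ c))) ⟩
      (λ e → ∂₁ v (dart e)) ∙ (λ e → A₁ e f)
        ≡⟨ column ⟩
      false ∎
      where
      column : (λ e → ∂₁ v (dart e)) ∙ (λ e → A₁ e f) ≡ false
      column with δ f f₀
      ... | true = ∂z≡0 v
      ... | false = ∂₁∂₂≡0 v f
    solution = annihilated-kernel size B B-indep A BA≡0
    x = proj₁ solution
    -- In the solution, `x f₀` is the coefficient of `z` and not of the face `f₀`, so the value at
    -- `f₀` is reset to `false`.
    g : Fin nF → Bool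
    g f = not (δ f f₀) ∧ x f
    relation : ∀ e → x f₀ ∧ z e xor (g (face (dart e)) xor g (face (α (dart e)))) ≡ false
    relation e = begin
      x f₀ ∧ z e xor (g (face d) xor g (face (α d)))
        ≡⟨ cong₂ _xor_ (sym (∑-δ f₀ (λ f → x f ∧ z e))) (cong₂ _xor_ (sym (∑-δ (face d) g)) (sym (∑-δ (face (α d)) g))) ⟩
      p xor ((λ f → δ f (face d)) ∙ g xor (λ f → δ f (face (α d))) ∙ g)
        ≡⟨ cong (p xor_) (∙-distribʳ-xor (λ f → δ f (face d)) (λ f → δ f (face (α d))) g) ⟨
      p xor (λ f → ∂₂ f d) ∙ g
        ≡⟨ ∑-xor ⟨
      ∑ (λ f → δ f f₀ ∧ (x f ∧ z e) xor ∂₂ f d ∧ g f)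
        ≡⟨ ∑-cong (λ f → regroup (δ f f₀) (x f) (z e) (∂₂ f d)) ⟩
      A₁ e ∙ x
        ≡⟨ subst (λ s → A₀ s ∙ x ≡ false) (splitAt-join nC nE (inj₂ e)) (proj₂ (proj₂ solution) (join nC nE (inj₂ e))) ⟩
      false ∎
      where
      d = dart e
      p = ∑ (λ f → δ f f₀ ∧ (x f ∧ z e))
      regroup : ∀ b x z t → b ∧ (x ∧ z) xor t ∧ (not b ∧ x) ≡ (if b then z else t) ∧ x
      regroup true x z t = trans (cong (x ∧ z xor_) (∧-zeroʳ t)) (trans (xor-identityʳ _) (∧-comm x z))
      regroup false x z t = refl
    ∂g : Fin nD → Bool
    ∂g d = g (face d) xor g (face (α d))
    ∂g≡xz : ∀ d → ∂g d ≡ x f₀ ∧ z (edge d)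
    ∂g≡xz d = trans (sym (dart-edge ∂g (swap-α g face) d)) (sym (xor-false⇒≡ (relation (edge d))))
    -- Otherwise `g` coincides with `x` and has no boundary, so it is constantly `false`, although
    -- `x` is nonzero.
    x₀≡1 : x f₀ ≡ true
    x₀≡1 with x f₀ in x₀
    ... | true = refl
    ... | false = contradiction (trans (sym xc≡1) (trans (sym (gx c)) (trans (g-const c f₀) (gx₀)))) λ ()
      where
      c = proj₁ (proj₁ (proj₂ solution))
      xc≡1 = proj₂ (proj₁ (proj₂ solution))
      gx₀ : g f₀ ≡ false
      gx₀ = cong (λ b → not b ∧ x f₀) (δ-refl f₀)
      gx : ∀ f → g f ≡ x f
      gx f with f ≟ f₀
      ... | yes refl = sym x₀
      ... | no _ = refl
      g-const = closed-constant {g} (λ d → trans (∂g≡xz d) (cong (_∧ z (edge d)) x₀))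
    g-bounds : Bounds g z
    g-bounds d = trans (∂g≡xz d) (cong (_∧ z (edge d)) x₀≡1)

-- Truth tables and Boolean comparison of numbers.

everywhere : ∀ n → (Vec Bool n → Bool) → Bool
everywhere zero f = f []
everywhere (suc n) f = everywhere n (f ∘ (true ∷_)) ∧ everywhere n (f ∘ (false ∷_))

∧-true : ∀ {a b} → a ∧ b ≡ true → a ≡ true × b ≡ true
∧-true {true} {true} _ = refl , refl

-- Allows a Boolean claim to be proved by computing its whole truth table.
tautology : ∀ {n} (f : Vec Bool n → Bool) → everywhere n f ≡ true → ∀ v → f v ≡ true
tautology f holds [] = holds
tautology f holds (true ∷ v) = tautology (f ∘ (true ∷_)) (proj₁ (∧-true holds)) v
tautology f holds (false ∷ v) = tautology (f ∘ (false ∷_)) (proj₂ (∧-true {everywhere _ (f ∘ (true ∷_))} holds)) v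

infix 4 _<ᵇ_
_<ᵇ_ : ℕ → ℕ → Bool
m <ᵇ n = ⌊ m <? n ⌋

<ᵇ-true : ∀ {m n} → m < n → (m <ᵇ n) ≡ true
<ᵇ-true {m} {n} m<n with m <? n
... | yes _ = refl
... | no m≮n = contradiction m<n m≮n

<ᵇ-false : ∀ {m n} → n ≤ m → (m <ᵇ n) ≡ false
<ᵇ-false {m} {n} n≤m with m <? n
... | yes m<n = contradiction (<-≤-trans m<n n≤m) (<-irrefl refl)
... | no _ = refl

<ᵇ-not : ∀ {m n} → m ≢ n → (m <ᵇ n) ≡ not (n <ᵇ m)
<ᵇ-not {m} {n} m≢n with m <? n
... | yes m<n = cong not (sym (<ᵇ-false (<⇒≤ m<n)))
... | no m≮n = cong not (sym (<ᵇ-true (≤∧≢⇒< (≮⇒≥ m≮n) (m≢n ∘ sym))))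

-- The comparisons a < c, a < d, b < c, b < d do not form a cycle a < c ≤ b < d ≤ a or its reverse.
acyclic : Bool → Bool → Bool → Bool → Bool
acyclic ac ad bc bd = not (ac ∧ bd ∧ not (ad ∨ bc)) ∧ not (ad ∧ bc ∧ not (ac ∨ bd))

<ᵇ-acyclic : ∀ a b c d → acyclic (a <ᵇ c) (a <ᵇ d) (b <ᵇ c) (b <ᵇ d) ≡ true
<ᵇ-acyclic a b c d with a <? c | a <? d | b <? c | b <? d
... | yes a<c | no a≮d | no b≮c | yes b<d =
  contradiction (<-≤-trans (<-≤-trans a<c (≮⇒≥ b≮c)) (<⇒≤ (<-≤-trans b<d (≮⇒≥ a≮d)))) (<-irrefl refl)
... | no a≮c | yes a<d | yes b<c | no b≮d =
  contradiction (<-≤-trans (<-≤-trans a<d (≮⇒≥ b≮d)) (<⇒≤ (<-≤-trans b<c (≮⇒≥ a≮c)))) (<-irrefl refl)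
... | yes _ | yes _ | yes _ | yes _ = refl
... | yes _ | yes _ | yes _ | no _ = refl
... | yes _ | yes _ | no _ | yes _ = refl
... | yes _ | yes _ | no _ | no _ = refl
... | yes _ | no _ | yes _ | yes _ = refl
... | yes _ | no _ | yes _ | no _ = refl
... | yes _ | no _ | no _ | no _ = refl
... | no _ | yes _ | yes _ | yes _ = refl
... | no _ | yes _ | no _ | yes _ = refl
... | no _ | yes _ | no _ | no _ = refl
... | no _ | no _ | yes _ | yes _ = refl
... | no _ | no _ | yes _ | no _ = refl
... | no _ | no _ | no _ | yes _ = refl
... | no _ | no _ | no _ | no _ = refl

infixr 4 _⇒_
_⇒_ : Bool → Bool → Bool
a ⇒ b = not a ∨ b

modus-ponens : ∀ {a b} → a ≡ true → (a ⇒ b) ≡ true → b ≡ true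
modus-ponens refl b≡true = b≡true

∧-xor-≡ : ∀ a {b c} → b ≡ c → a ∧ (b xor c) ≡ false
∧-xor-≡ a {b} refl = trans (cong (a ∧_) (xor-same b)) (∧-zeroʳ a)

some₃ : (f : Fin 3 → Bool) → (∃ λ i → f i ≡ true) → f 0F ∨ f 1F ∨ f 2F ≡ true
some₃ f (0F , eq) rewrite eq = refl
some₃ f (1F , eq) rewrite eq = ∨-zeroʳ (f 0F)
some₃ f (2F , eq) rewrite eq | ∨-zeroʳ (f 1F) = ∨-zeroʳ (f 0F)

-- The parity cross of Drawing below, for edges ab and cd: p and q list the comparisons
-- a < c, a < d, b < c, b < d in the second and in the third order (and t in the first).
crossing : (p₁ p₂ p₃ p₄ q₁ q₂ q₃ q₄ : Bool) → Bool
crossing p₁ p₂ p₃ p₄ q₁ q₂ q₃ q₄ =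
  ((((not q₁ ∧ not q₂) ∧ (not p₁ xor not p₂)) xor (p₁ xor p₂)) xor
   (((not q₃ ∧ not q₄) ∧ (not p₃ xor not p₄)) xor (p₃ xor p₄))) xor
  (((q₁ ∧ q₃) ∧ (p₁ xor p₃)) xor ((q₂ ∧ q₄) ∧ (p₂ xor p₄)))

-- After acyclicity, the hypotheses say that a and b are each above both of c, d in some order, and
-- that c and d are each above both of a, b in some order. All 4096 assignments are checked by
-- computation.
noncrossing : ∀ t₁ t₂ t₃ t₄ p₁ p₂ p₃ p₄ q₁ q₂ q₃ q₄ →
  acyclic p₁ p₂ p₃ p₄ ≡ true → acyclic q₁ q₂ q₃ q₄ ≡ true →
  (not t₁ ∧ not t₂) ∨ (not p₁ ∧ not p₂) ∨ (not q₁ ∧ not q₂) ≡ true →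
  (not t₃ ∧ not t₄) ∨ (not p₃ ∧ not p₄) ∨ (not q₃ ∧ not q₄) ≡ true →
  (t₁ ∧ t₃) ∨ (p₁ ∧ p₃) ∨ (q₁ ∧ q₃) ≡ true →
  (t₂ ∧ t₄) ∨ (p₂ ∧ p₄) ∨ (q₂ ∧ q₄) ≡ true →
  crossing p₁ p₂ p₃ p₄ q₁ q₂ q₃ q₄ ≡ false
noncrossing t₁ t₂ t₃ t₄ p₁ p₂ p₃ p₄ q₁ q₂ q₃ q₄ h₁ h₂ h₃ h₄ h₅ h₆ =
  not-injective (modus-ponens h₆ (modus-ponens h₅ (modus-ponens h₄ (modus-ponens h₃ (modus-ponens h₂ (modus-ponens h₁
    (tautology claim refl (t₁ ∷ t₂ ∷ t₃ ∷ t₄ ∷ p₁ ∷ p₂ ∷ p₃ ∷ p₄ ∷ q₁ ∷ q₂ ∷ q₃ ∷ q₄ ∷ []))))))))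
  where
  claim : Vec Bool 12 → Bool
  claim (t₁ ∷ t₂ ∷ t₃ ∷ t₄ ∷ p₁ ∷ p₂ ∷ p₃ ∷ p₄ ∷ q₁ ∷ q₂ ∷ q₃ ∷ q₄ ∷ []) =
    acyclic p₁ p₂ p₃ p₄ ⇒ acyclic q₁ q₂ q₃ q₄ ⇒
    (not t₁ ∧ not t₂) ∨ (not p₁ ∧ not p₂) ∨ (not q₁ ∧ not q₂) ⇒
    (not t₃ ∧ not t₄) ∨ (not p₃ ∧ not p₄) ∨ (not q₃ ∧ not q₄) ⇒
    (t₁ ∧ t₃) ∨ (p₁ ∧ p₃) ∨ (q₁ ∧ q₃) ⇒
    (t₂ ∧ t₄) ∨ (p₂ ∧ p₄) ∨ (q₂ ∧ q₄) ⇒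
    not (crossing p₁ p₂ p₃ p₄ q₁ q₂ q₃ q₄)

-- The drawing given by three linear orders.

module Drawing (M : PlaneMap) (plane : IsPlane M)
  (L : Fin 3 → Vtx M ⊎ Fin (PlaneMap.nF M) → ℕ)
  (L-injective : ∀ i → Injective _≡_ _≡_ (L i))
  (L-realizes : ∀ x y → PVF M x y ⇔ (∀ i → L i x ≤ L i y)) where
  open PlaneMap M
  open PlaneHomology M plane
  open ≡-Reasoning

  rank : Fin 3 → Fin nV → ℕ
  rank i v = L i (inj₁ (inj₁ v))

  rank-≢ : ∀ i {u v} → u ≢ v → rank i u ≢ rank i v
  rank-≢ i u≢v eq = u≢v (inj₁-injective (inj₁-injective (L-injective i eq)))

  lt : Fin 3 → Fin nV → Fin nV → Bool
  lt i u v = rank i u <ᵇ rank i v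

  lt-not : ∀ i {u v} → u ≢ v → lt i u v ≡ not (lt i v u)
  lt-not i u≢v = <ᵇ-not (rank-≢ i u≢v)

  -- Distinct vertices are incomparable in the poset, so `u` cannot be below `v` in all three
  -- orders.
  antichain : ∀ {u v} → rank 0F u < rank 0F v → rank 2F u < rank 2F v → lt 1F u v ≡ false
  antichain {u} {v} u<₀v u<₂v = <ᵇ-false (<⇒≤ (≰⇒> λ u≤₁v →
    <⇒≢ u<₀v (cong (L 0F) (cong inj₁ (Equivalence.from (L-realizes (inj₁ (inj₁ u)) (inj₁ (inj₁ v)))
      λ { 0F → <⇒≤ u<₀v ; 1F → u≤₁v ; 2F → <⇒≤ u<₂v })))))

  Separated : Fin nV → Fin nD → Set
  Separated v d = ∃ λ i → rank i (vert d) < rank i v × rank i (vert (α d)) < rank i v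

  -- Some order puts `f` below `v`, and every vertex on the boundary of `f` is below `f` in all
  -- orders.
  face-separated : ∀ {v f} → ¬ Inc M (inj₁ v) f →
    ∃ λ i → ∀ d → face d ≡ f → rank i (vert d) < rank i v × rank i (vert (α d)) < rank i v
  face-separated {v} {f} v∉f = i , λ { d refl →
      ≤-<-trans (Equivalence.to (L-realizes (inj₁ (inj₁ (vert d))) (inj₂ f)) (d , refl , refl) i) f<v
    -- The far end of `d` lies on `f` through the next dart of the boundary walk, `σ (α d)`.
    , ≤-<-trans (Equivalence.to (L-realizes (inj₁ (inj₁ (vert (α d)))) (inj₂ f)) (σ (α d) , vert-σ (α d) , face-φ d) i) f<v }
    where
    witness = ¬∀⟶∃¬ 3 (λ i → L i (inj₁ (inj₁ v)) ≤ L i (inj₂ f)) (λ i → _ ≤? _)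
                (v∉f ∘ Equivalence.from (L-realizes (inj₁ (inj₁ v)) (inj₂ f)))
    i = proj₁ witness
    f<v : L i (inj₂ f) < rank i v
    f<v = ≰⇒> (proj₂ witness)

  -- Draw u at (rank 1F u, rank 2F u) and an edge as a horizontal segment at the height of its
  -- higher end followed by a vertical one down to its lower end; ray v d tells whether
  -- the downward vertical ray from v meets the edge of d.
  ray : Fin nV → Fin nD → Bool
  ray v d = (lt 2F (vert d) v ∧ lt 2F (vert (α d)) v) ∧ (lt 1F (vert d) v xor lt 1F (vert (α d)) v)

  ray-α : ∀ v d → ray v (α d) ≡ ray v d
  ray-α v d = cong₂ _∧_
    (trans (cong (λ d′ → lt 2F (vert (α d)) v ∧ lt 2F (vert d′) v) (α-invol d)) (∧-comm (lt 2F (vert (α d)) v) _))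
    (swap-α (λ u → lt 1F u v) vert d)

  -- The reason depends on the separating order. In the first, boundary vertices lower than `v` in
  -- the drawing are not to its left, by `antichain`. In the second, the whole boundary is to the
  -- left of `v`. In the third, it is all lower than `v`, so the ray parity of an edge is its change
  -- of side, which telescopes along the boundary walks.
  face-ray : ∀ {v f} → ¬ Inc M (inj₁ v) f → ∑ (λ d → δ f (face d) ∧ ray v d) ≡ false
  face-ray {v} {f} v∉f with face-separated v∉f
  ... | 0F , below = ∑-false vanish
    where
    vanish : ∀ d → δ f (face d) ∧ ray v d ≡ false
    vanish d with f ≟ face d
    ... | no _ = refl
    ... | yes refl with rank 2F (vert d) <? rank 2F v | rank 2F (vert (α d)) <? rank 2F v
    ...   | no _ | _ = refl
    ...   | yes _ | no _ = refl
    ...   | yes a<v | yes b<v = cong₂ _xor_ (antichain (proj₁ (below d refl)) a<v) (antichain (proj₂ (below d refl)) b<v)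
  ... | 1F , below = ∑-false vanish
    where
    vanish : ∀ d → δ f (face d) ∧ ray v d ≡ false
    vanish d with f ≟ face d
    ... | no _ = refl
    ... | yes refl = ∧-xor-≡ (lt 2F (vert d) v ∧ lt 2F (vert (α d)) v)
                       (trans (<ᵇ-true (proj₁ (below d refl))) (sym (<ᵇ-true (proj₂ (below d refl)))))
  ... | 2F , below = begin
    ∑ (λ d → δ f (face d) ∧ ray v d)   ≡⟨ ∑-cong telescope ⟩
    ∑ (λ d → K d xor K (σ (α d)))      ≡⟨ ∑-xor ⟩
    ∑ K xor ∑ (K ∘ σ ∘ α)              ≡⟨ cong (∑ K xor_) (trans (∑-α (K ∘ σ)) (∑-σ K)) ⟩
    ∑ K xor ∑ K                        ≡⟨ xor-same (∑ K) ⟩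
    false                              ∎
    where
    K : Fin nD → Bool
    K d = δ f (face d) ∧ lt 1F (vert d) v
    telescope : ∀ d → δ f (face d) ∧ ray v d ≡ K d xor K (σ (α d))
    telescope d rewrite face-φ d | vert-σ (α d) with f ≟ face d
    ... | no _ = refl
    ... | yes refl = cong (_∧ (lt 1F (vert d) v xor lt 1F (vert (α d)) v))
                       (cong₂ _∧_ (<ᵇ-true (proj₁ (below d refl))) (<ᵇ-true (proj₂ (below d refl))))

  Clear : (Fin nF → Bool) → Fin nV → Set
  Clear g v = ∀ d → vert d ≡ v → g (face d) ≡ false

  Clear-∉ : ∀ {g v f} → Clear g v → g f ≡ true → ¬ Inc M (inj₁ v) f
  Clear-∉ clear gf≡1 (d , vd≡v , refl) = contradiction (trans (sym gf≡1) (clear d vd≡v)) λ ()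

  -- Modulo 2, the ray meets `z` as often as it meets the boundary walks of the faces in `g`, and
  -- `v` is on none of these faces.
  winding : ∀ {g z v} → Bounds g z → Clear g v → z ∙ (ray v ∘ dart) ≡ false
  winding {g} {z} {v} ∂g≡z clear = begin
    z ∙ (ray v ∘ dart)
      ≡⟨ ∑-cong split ⟩
    ∑ (λ e → G (dart e) xor G (α (dart e)))
      ≡⟨ ∑-darts G ⟨
    ∑ (λ d → g (face d) ∧ ray v d)
      ≡⟨ ∑-cong (λ d → cong (_∧ ray v d) (∑-δ (face d) g)) ⟨
    ∑ (λ d → ∑ (λ f → δ f (face d) ∧ g f) ∧ ray v d)
      ≡⟨ ∑-cong (λ d → ∧-distribʳ-∑ (ray v d) _) ⟩
    ∑ (λ d → ∑ (λ f → (δ f (face d) ∧ g f) ∧ ray v d))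
      ≡⟨ ∑-comm _ ⟩
    ∑ (λ f → ∑ (λ d → (δ f (face d) ∧ g f) ∧ ray v d))
      ≡⟨ ∑-false face-sum ⟩
    false ∎
    where
    G : Fin nD → Bool
    G d = g (face d) ∧ ray v d
    split : ∀ e → z e ∧ ray v (dart e) ≡ G (dart e) xor G (α (dart e))
    split e = begin
      z e ∧ ray v d
        ≡⟨ cong (λ e → z e ∧ ray v d) (edge-dart e) ⟨
      z (edge d) ∧ ray v d
        ≡⟨ cong (_∧ ray v d) (∂g≡z d) ⟨
      (g (face d) xor g (face (α d))) ∧ ray v d
        ≡⟨ ∧-distribʳ-xor (ray v d) (g (face d)) _ ⟩
      G d xor g (face (α d)) ∧ ray v d
        ≡⟨ cong (λ b → G d xor g (face (α d)) ∧ b) (ray-α v d) ⟨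
      G d xor G (α d) ∎
      where d = dart e
    face-sum : ∀ f → ∑ (λ d → (δ f (face d) ∧ g f) ∧ ray v d) ≡ false
    face-sum f with g f in gf
    ... | false = ∑-false λ d → cong (_∧ ray v d) (∧-zeroʳ (δ f (face d)))
    ... | true = trans (∑-cong λ d → cong (_∧ ray v d) (∧-identityʳ (δ f (face d)))) (face-ray {v} {f} (Clear-∉ {g} clear gf))

  -- An edge of `z` has a face of `g` on one side, and `v` is not on that face.
  clear-separated : ∀ {g z v} → Bounds g z → Clear g v → ∀ d → z (edge d) ≡ true → Separated v d
  clear-separated {g} ∂g≡z clear d z≡1 with g (face d) in gd
  ... | true = let i , below = face-separated (Clear-∉ {g} clear gd) in i , below d refl
  ... | false =
    let i , below = face-separated (Clear-∉ {g} clear gαd)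
        b<v , a<v = below (α d) refl
    in i , subst (λ d′ → rank i (vert d′) < rank i _) (α-invol d) a<v , b<v
    where
    gαd : g (face (α d)) ≡ true
    gαd = trans (sym (cong (_xor g (face (α d))) gd)) (trans (∂g≡z d) z≡1)

  -- For `u` other than the ends of `d′` this is the parity of the upward ray from `u`: the added
  -- term tells whether the entire vertical line through `u` meets the edge.
  drop : Fin nD → Fin nV → Bool
  drop d′ u = ray u d′ xor (lt 1F u (vert d′) xor lt 1F u (vert (α d′)))

  -- The parity of the number of crossings of the edges of d and d′: moving along the edge of d,
  -- the ray parity against d′ changes at crossings and when passing above an end of d′.
  cross : Fin nD → Fin nD → Bool
  cross d d′ = (drop d′ (vert d) xor drop d′ (vert (α d))) xor (ray (vert d′) d xor ray (vert (α d′)) d)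

  cross-αˡ : ∀ d d′ → cross (α d) d′ ≡ cross d d′
  cross-αˡ d d′ = cong₂ _xor_ (swap-α (drop d′) vert d) (cong₂ _xor_ (ray-α (vert d′) d) (ray-α (vert (α d′)) d))

  cross-αʳ : ∀ d d′ → cross d (α d′) ≡ cross d d′
  cross-αʳ d d′ = cong₂ _xor_ (cong₂ _xor_ (drop-α (vert d)) (drop-α (vert (α d)))) (swap-α (λ v → ray v d) vert d′)
    where
    drop-α : ∀ u → drop (α d′) u ≡ drop d′ u
    drop-α u = cong₂ _xor_ (ray-α u d′) (swap-α (lt 1F u) vert d′)

  ray-loop : ∀ v {d} → vert d ≡ vert (α d) → ray v d ≡ false
  ray-loop v {d} eq = ∧-xor-≡ (lt 2F (vert d) v ∧ lt 2F (vert (α d)) v) (cong (λ u → lt 1F u v) eq)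

  cross-loopˡ : ∀ {d d′} → vert d ≡ vert (α d) → cross d d′ ≡ false
  cross-loopˡ {d} {d′} eq = cong₂ _xor_
    (trans (cong (λ v → drop d′ (vert d) xor drop d′ v) (sym eq)) (xor-same (drop d′ (vert d))))
    (cong₂ _xor_ (ray-loop (vert d′) eq) (ray-loop (vert (α d′)) eq))

  cross-loopʳ : ∀ {d d′} → vert d′ ≡ vert (α d′) → cross d d′ ≡ false
  cross-loopʳ {d} {d′} eq = cong₂ _xor_ (cong₂ _xor_ (drop-loop (vert d)) (drop-loop (vert (α d))))
    (trans (cong (λ v → ray (vert d′) d xor ray v d) (sym eq)) (xor-same (ray (vert d′) d)))
    where
    drop-loop : ∀ u → drop d′ u ≡ false
    drop-loop u = cong₂ _xor_ (ray-loop u eq)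
      (trans (cong (λ v → lt 1F u (vert d′) xor lt 1F u v) (sym eq)) (xor-same (lt 1F u (vert d′))))

  cross-separated : ∀ {d d′} → Separated (vert d) d′ → Separated (vert (α d)) d′ →
    Separated (vert d′) d → Separated (vert (α d′)) d → cross d d′ ≡ false
  cross-separated {d} {d′} sa@(ia , c<a , c′<a) sb@(ib , c<b , c′<b) sc sc′ = begin
    cross d d′
      ≡⟨ cong₂ (λ r s → ((r xor (lt 1F a c xor lt 1F a c′)) xor (s xor (lt 1F b c xor lt 1F b c′))) xor (ray c d xor ray c′ d))
           (ray-flip (rank-≢′ c<a) (rank-≢′ c′<a)) (ray-flip (rank-≢′ c<b) (rank-≢′ c′<b)) ⟩
    crossing (lt 1F a c) (lt 1F a c′) (lt 1F b c) (lt 1F b c′) (lt 2F a c) (lt 2F a c′) (lt 2F b c) (lt 2F b c′)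
      ≡⟨ noncrossing (lt 0F a c) (lt 0F a c′) (lt 0F b c) (lt 0F b c′)
           (lt 1F a c) (lt 1F a c′) (lt 1F b c) (lt 1F b c′) (lt 2F a c) (lt 2F a c′) (lt 2F b c) (lt 2F b c′)
           (<ᵇ-acyclic (rank 1F a) (rank 1F b) (rank 1F c) (rank 1F c′))
           (<ᵇ-acyclic (rank 2F a) (rank 2F b) (rank 2F c) (rank 2F c′))
           (above a sa) (above b sb) (below c sc) (below c′ sc′) ⟩
    false ∎
    where
    a = vert d
    b = vert (α d)
    c = vert d′
    c′ = vert (α d′)
    rank-≢′ : ∀ {i u v} → rank i u < rank i v → v ≢ u
    rank-≢′ u<v refl = <-irrefl refl u<v
    -- Separation makes `v` different from the ends of `d′`, so comparisons can be reversed until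
    -- all of them have an end of `d` on the left.
    ray-flip : ∀ {v} → v ≢ c → v ≢ c′ →
      ray v d′ ≡ (not (lt 2F v c) ∧ not (lt 2F v c′)) ∧ (not (lt 1F v c) xor not (lt 1F v c′))
    ray-flip v≢c v≢c′ = cong₂ _∧_ (cong₂ _∧_ (lt-not 2F (v≢c ∘ sym)) (lt-not 2F (v≢c′ ∘ sym)))
                                  (cong₂ _xor_ (lt-not 1F (v≢c ∘ sym)) (lt-not 1F (v≢c′ ∘ sym)))
    above : ∀ v → Separated v d′ →
      (not (lt 0F v c) ∧ not (lt 0F v c′)) ∨ (not (lt 1F v c) ∧ not (lt 1F v c′)) ∨ (not (lt 2F v c) ∧ not (lt 2F v c′)) ≡ true
    above v (i , c<v , c′<v) = some₃ (λ i → not (lt i v c) ∧ not (lt i v c′))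
      (i , cong₂ (λ p q → not p ∧ not q) (<ᵇ-false (<⇒≤ c<v)) (<ᵇ-false (<⇒≤ c′<v)))
    below : ∀ v → Separated v d → (lt 0F a v ∧ lt 0F b v) ∨ (lt 1F a v ∧ lt 1F b v) ∨ (lt 2F a v ∧ lt 2F b v) ≡ true
    below v (i , a<v , b<v) = some₃ (λ i → lt i a v ∧ lt i b v) (i , cong₂ _∧_ (<ᵇ-true a<v) (<ᵇ-true b<v))

-- Parity sums over lists.

⨁ : ∀ {A : Set} → (A → Bool) → List A → Bool
⨁ f [] = false
⨁ f (a ∷ as) = f a xor ⨁ f as

interchange : ∀ a b c d → (a xor b) xor (c xor d) ≡ (a xor c) xor (b xor d)
interchange = solve 4 (λ a b c d → (a :+ b) :+ (c :+ d) := (a :+ c) :+ (b :+ d)) refl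
  where open xor-∧-Solver

⨁-cong : ∀ {A : Set} {f g : A → Bool} → f ≗ g → ∀ as → ⨁ f as ≡ ⨁ g as
⨁-cong f≗g [] = refl
⨁-cong f≗g (a ∷ as) = cong₂ _xor_ (f≗g a) (⨁-cong f≗g as)

⨁-xor : ∀ {A : Set} (f g : A → Bool) as → ⨁ (λ a → f a xor g a) as ≡ ⨁ f as xor ⨁ g as
⨁-xor f g [] = refl
⨁-xor f g (a ∷ as) = trans (cong ((f a xor g a) xor_) (⨁-xor f g as)) (interchange (f a) (g a) _ _)

⨁-true : ∀ {A : Set} {f : A → Bool} as → ⨁ f as ≡ true → ∃ λ a → a ∈ as × f a ≡ true
⨁-true {f = f} (a ∷ as) eq with f a in fa
... | true = a , here refl , fa
... | false = let a′ , a′∈as , fa′ = ⨁-true {f = f} as eq in a′ , there a′∈as , fa′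

opaque
  unfolding ∑

  ∑₆ : (f : Fin 6 → Bool) → ∑ f ≡ f 0F xor (f 1F xor (f 2F xor (f 3F xor (f 4F xor (f 5F xor false)))))
  ∑₆ f = refl

-- Combinatorics of K₄ and the parity form of Radon's theorem.

src tgt : Fin 6 → Fin 4
src k = proj₁ (k4ends k)
tgt k = proj₂ (k4ends k)

end? : Fin 4 → Fin 6 → Bool
end? x k = δ x (src k) ∨ δ x (tgt k)

-- The K₄-edges of the triangle opposite to x.
off : Fin 4 → Fin 6 → Bool
off x k = not (end? x k)

opaque
  src-end : ∀ k → end? (src k) k ≡ true
  src-end = from-yes (all? λ k → end? (src k) k ≟ᵇ true)

  tgt-end : ∀ k → end? (tgt k) k ≡ true
  tgt-end = from-yes (all? λ k → end? (tgt k) k ≟ᵇ true)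

  -- In the order of `k4ends`, reversing the index sends every edge to the disjoint one.
  end-off-opposite : ∀ x k → end? x k ≡ true → off x (opposite k) ≡ true
  end-off-opposite = from-yes (all? λ x → all? λ k → (end? x k ≟ᵇ true) →-dec (off x (opposite k) ≟ᵇ true))

  end-opposite-off : ∀ x k → end? x (opposite k) ≡ true → off x k ≡ true
  end-opposite-off = from-yes (all? λ x → all? λ k → (end? x (opposite k) ≟ᵇ true) →-dec (off x k ≟ᵇ true))

  common-end : ∀ k l x y → end? x k ≡ true → end? x l ≡ true → end? y k ≡ true → end? y l ≡ true →
               k ≡ l ⊎ x ≡ y
  common-end = from-yes (all? λ k → all? λ l → all? λ x → all? λ y →
    (end? x k ≟ᵇ true) →-dec (end? x l ≟ᵇ true) →-dec (end? y k ≟ᵇ true) →-dec (end? y l ≟ᵇ true) →-dec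
    (k ≟ l ⊎-dec x ≟ y))

triangle-closed : ∀ x (β : Fin 4 → Bool) → off x ∙ (λ k → β (src k) xor β (tgt k)) ≡ false
triangle-closed x β = trans (∑₆ _) (closed x)
  where
  open xor-∧-Solver
  triangle : ∀ a b c → (a xor b) xor ((a xor c) xor ((b xor c) xor false)) ≡ false
  triangle = solve 3 (λ a b c → (a :+ b) :+ ((a :+ c) :+ ((b :+ c) :+ con false)) := con false) refl
  s : Fin 4 → Fin 6 → Bool
  s x k = off x k ∧ (β (src k) xor β (tgt k))
  closed : ∀ x → s x 0F xor (s x 1F xor (s x 2F xor (s x 3F xor (s x 4F xor (s x 5F xor false))))) ≡ false
  closed 0F = triangle (β 1F) (β 2F) (β 3F)
  closed 1F = triangle (β 0F) (β 2F) (β 3F)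
  closed 2F = triangle (β 0F) (β 1F) (β 3F)
  closed 3F = triangle (β 0F) (β 1F) (β 2F)

module _ (ρ : Fin 4 → Fin 6 → Bool) (ℓ : Fin 4 → Fin 4 → Bool) where
  -- `ρ x k` stands for the ray parity of vertex `x` against path `k`, and `ℓ x y` for `x` being to
  -- the left of `y`. `overhang` and `crossings` are `drop` and `cross` for whole paths.
  overhang : Fin 6 → Fin 4 → Bool
  overhang k x = ρ x k xor (ℓ x (src k) xor ℓ x (tgt k))

  crossings : Fin 6 → Bool
  crossings k = (overhang k′ (src k) xor overhang k′ (tgt k)) xor (ρ (src k′) k xor ρ (tgt k′) k)
    where k′ = opposite k

  -- Every ρ x k occurs twice, and so does every comparison, up to three reversals.
  radon : (∀ x y → x ≢ y → ℓ x y ≡ not (ℓ y x)) →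
    (∀ x → off x ∙ ρ x ≡ false) → (∀ k → crossings k ≡ false) → ⊥
  radon ℓ-not tri≡0 cross≡0 = contradiction (trans (sym total≡1) total≡0) λ ()
    where
    open xor-∧-Solver
    total : Bool
    total = ((off 0F ∙ ρ 0F xor off 1F ∙ ρ 1F) xor (off 2F ∙ ρ 2F xor off 3F ∙ ρ 3F)) xor
            (crossings 0F xor (crossings 1F xor crossings 2F))
    total≡0 : total ≡ false
    total≡0 rewrite tri≡0 0F | tri≡0 1F | tri≡0 2F | tri≡0 3F | cross≡0 0F | cross≡0 1F | cross≡0 2F = refl
    total≡1 : total ≡ true
    total≡1 rewrite ∑₆ (λ k → off 0F k ∧ ρ 0F k) | ∑₆ (λ k → off 1F k ∧ ρ 1F k)
                  | ∑₆ (λ k → off 2F k ∧ ρ 2F k) | ∑₆ (λ k → off 3F k ∧ ρ 3F k)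
                  | ℓ-not 2F 1F (λ ()) | ℓ-not 3F 1F (λ ()) | ℓ-not 3F 2F (λ ()) =
      solve 18 (λ r03 r04 r05 r11 r12 r15 r20 r22 r24 r30 r31 r33 l01 l02 l03 l12 l13 l23 →
        (((r03 :+ (r04 :+ (r05 :+ con false))) :+ (r11 :+ (r12 :+ (r15 :+ con false)))) :+
         ((r20 :+ (r22 :+ (r24 :+ con false))) :+ (r30 :+ (r31 :+ (r33 :+ con false))))) :+
        ((((r05 :+ (l02 :+ l03)) :+ (r15 :+ (l12 :+ l13))) :+ (r20 :+ r30)) :+
         ((((r04 :+ (l01 :+ l03)) :+ (r24 :+ ((con true :+ l12) :+ l23))) :+ (r11 :+ r31)) :+
          (((r03 :+ (l01 :+ l02)) :+ (r33 :+ ((con true :+ l13) :+ (con true :+ l23)))) :+ (r12 :+ r22))))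
        := con true) refl
        (ρ 0F 3F) (ρ 0F 4F) (ρ 0F 5F) (ρ 1F 1F) (ρ 1F 2F) (ρ 1F 5F) (ρ 2F 0F) (ρ 2F 2F) (ρ 2F 4F)
        (ρ 3F 0F) (ρ 3F 1F) (ρ 3F 3F) (ℓ 0F 1F) (ℓ 0F 2F) (ℓ 0F 3F) (ℓ 1F 2F) (ℓ 1F 3F) (ℓ 2F 3F)

-- Paths, triangles and regions of the subdivision.

module K4 (M : PlaneMap) (plane : IsPlane M) (S : K4Subdivision M)
  (L : Fin 3 → Vtx M ⊎ Fin (PlaneMap.nF M) → ℕ)
  (L-injective : ∀ i → Injective _≡_ _≡_ (L i))
  (L-realizes : ∀ x y → PVF M x y ⇔ (∀ i → L i x ≤ L i y)) where
  open PlaneMap M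
  open K4Subdivision S
  open PlaneHomology M plane
  open Drawing M plane L L-injective L-realizes
  open ≡-Reasoning

  chainDarts : ∀ a xs b → Chain (Adj M) a xs b → List (Fin nD)
  chainDarts a [] b (d , _) = d ∷ []
  chainDarts a (x ∷ xs) b ((d , _) , c) = d ∷ chainDarts x xs b c

  telescope : ∀ (h : Fin nV → Bool) a xs b c →
    ⨁ (λ d → h (vert d) xor h (vert (α d))) (chainDarts a xs b c) ≡ h a xor h b
  telescope h a [] b (d , refl , refl) = xor-identityʳ _
  telescope h a (x ∷ xs) b ((d , refl , refl) , c) = begin
    (h a xor h x) xor ⨁ _ (chainDarts x xs b c)   ≡⟨ cong ((h a xor h x) xor_) (telescope h x xs b c) ⟩
    (h a xor h x) xor (h x xor h b)               ≡⟨ cancel (h a) (h x) (h b) ⟩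
    h a xor h b                                   ∎
    where
    open xor-∧-Solver
    cancel : ∀ a x b → (a xor x) xor (x xor b) ≡ a xor b
    cancel = solve 3 (λ a x b → (a :+ x) :+ (x :+ b) := a :+ b) refl

  chain-vertices : ∀ {d} a xs b c → d ∈ chainDarts a xs b c →
    (vert d ≡ a ⊎ vert d ∈ xs) × (vert (α d) ∈ xs ⊎ vert (α d) ≡ b)
  chain-vertices a [] b (d , va , vb) (here refl) = inj₁ va , inj₂ vb
  chain-vertices a (x ∷ xs) b ((d , va , vx) , c) (here refl) = inj₁ va , inj₁ (here vx)
  chain-vertices a (x ∷ xs) b (_ , c) (there d∈c) with chain-vertices x xs b c d∈c
  ... | inj₁ eq , inj₁ w∈xs = inj₂ (here eq) , inj₁ (there w∈xs)
  ... | inj₁ eq , inj₂ w≡b = inj₂ (here eq) , inj₂ w≡b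
  ... | inj₂ v∈xs , inj₁ w∈xs = inj₂ (there v∈xs) , inj₁ (there w∈xs)
  ... | inj₂ v∈xs , inj₂ w≡b = inj₂ (there v∈xs) , inj₂ w≡b

  pathDarts : Fin 6 → List (Fin nD)
  pathDarts k = chainDarts (branch (src k)) (inner k) (branch (tgt k)) (is-path k)

  OnPath : Fin 6 → Fin nV → Set
  OnPath k v = (∃ λ x → end? x k ≡ true × v ≡ branch x) ⊎ v ∈ inner k

  path-vertices : ∀ {k d} → d ∈ pathDarts k → OnPath k (vert d) × OnPath k (vert (α d))
  path-vertices {k} d∈k with chain-vertices (branch (src k)) (inner k) (branch (tgt k)) (is-path k) d∈k
  ... | v , w = from-src v , from-tgt w
    where
    from-src : ∀ {v} → v ≡ branch (src k) ⊎ v ∈ inner k → OnPath k v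
    from-src (inj₁ eq) = inj₁ (src k , src-end k , eq)
    from-src (inj₂ v∈) = inj₂ v∈
    from-tgt : ∀ {v} → v ∈ inner k ⊎ v ≡ branch (tgt k) → OnPath k v
    from-tgt (inj₁ v∈) = inj₂ v∈
    from-tgt (inj₂ eq) = inj₁ (tgt k , tgt-end k , eq)

  inner-OnPath : ∀ {k l v} → v ∈ inner k → OnPath l v → k ≡ l
  inner-OnPath {k} v∈k (inj₁ (x , _ , v≡x)) = contradiction v≡x (inner-not-branch k _ x v∈k)
  inner-OnPath v∈k (inj₂ v∈l) = inner-disjoint _ _ _ v∈k v∈l

  branch-OnPath : ∀ {x l} → OnPath l (branch x) → end? x l ≡ true
  branch-OnPath {l = l} (inj₁ (y , yl , eq)) = subst (λ x → end? x l ≡ true) (sym (branch-inj eq)) yl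
  branch-OnPath {x} {l} (inj₂ x∈l) = contradiction refl (inner-not-branch l _ x x∈l)

  -- An inner vertex is on one path only, so shared vertices are common ends, and distinct edges of
  -- K₄ have at most one of these.
  shared-vertex : ∀ {k l u v} → k ≢ l → OnPath k u → OnPath l u → OnPath k v → OnPath l v → u ≡ v
  shared-vertex k≢l (inj₂ u∈k) u∈l _ _ = contradiction (inner-OnPath u∈k u∈l) k≢l
  shared-vertex k≢l _ _ (inj₂ v∈k) v∈l = contradiction (inner-OnPath v∈k v∈l) k≢l
  shared-vertex {k} {l} k≢l (inj₁ (x , xk , refl)) x∈l (inj₁ (y , yk , refl)) y∈l
    with common-end k l x y xk (branch-OnPath x∈l) yk (branch-OnPath y∈l)
  ... | inj₁ k≡l = contradiction k≡l k≢l
  ... | inj₂ x≡y = cong branch x≡y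

  -- Multiplicity modulo 2: the path as a chain of edges.
  count : Fin 6 → Fin nE → Bool
  count k e = ⨁ (λ d → δ e (edge d)) (pathDarts k)

  count-vertices : ∀ {k} d → count k (edge d) ≡ true → OnPath k (vert d) × OnPath k (vert (α d))
  count-vertices {k} d eq with ⨁-true (pathDarts k) eq
  ... | d′ , d′∈k , δ≡1 with same-edge {d′} {d} (sym (δ-true δ≡1)) | path-vertices {k} d′∈k
  ...   | inj₁ refl | on = on
  ...   | inj₂ refl | v , w = w , subst (λ d → OnPath k (vert d)) (sym (α-invol d′)) v

  count-∙ : ∀ k (H : Fin nD → Bool) → (∀ d → H (α d) ≡ H d) → count k ∙ (H ∘ dart) ≡ ⨁ H (pathDarts k)
  count-∙ k H H-α = go (pathDarts k)
    where
    go : ∀ ds → (λ e → ⨁ (λ d → δ e (edge d)) ds) ∙ (H ∘ dart) ≡ ⨁ H ds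
    go [] = ∑-false λ _ → refl
    go (d ∷ ds) = trans (∙-distribʳ-xor (λ e → δ e (edge d)) (λ e → ⨁ (λ d → δ e (edge d)) ds) (H ∘ dart))
      (cong₂ _xor_ (trans (∑-δ (edge d) (H ∘ dart)) (dart-edge H H-α d)) (go ds))

  triangle : Fin 4 → Fin nE → Bool
  triangle x e = off x ∙ (λ k → count k e)

  triangle-∙ : ∀ x (H : Fin nD → Bool) → (∀ d → H (α d) ≡ H d) →
    triangle x ∙ (H ∘ dart) ≡ off x ∙ (λ k → ⨁ H (pathDarts k))
  triangle-∙ x H H-α = trans (sym (∙-swap (off x) count (H ∘ dart)))
    (∑-cong λ k → cong (off x k ∧_) (count-∙ k H H-α))

  triangle-cycle : ∀ x v → (λ e → ∂₁ v (dart e)) ∙ triangle x ≡ false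
  triangle-cycle x v = begin
    (∂₁ v ∘ dart) ∙ triangle x
      ≡⟨ ∑-cong (λ e → ∧-comm (∂₁ v (dart e)) (triangle x e)) ⟩
    triangle x ∙ (∂₁ v ∘ dart)
      ≡⟨ triangle-∙ x (∂₁ v) (swap-α (δ v) vert) ⟩
    off x ∙ (λ k → ⨁ (∂₁ v) (pathDarts k))
      ≡⟨ ∑-cong (λ k → cong (off x k ∧_) (telescope (δ v) _ (inner k) _ (is-path k))) ⟩
    off x ∙ (λ k → δ v (branch (src k)) xor δ v (branch (tgt k)))
      ≡⟨ triangle-closed x (δ v ∘ branch) ⟩
    false ∎

  triangle-avoids : ∀ {x v} → (∀ l → off x l ≡ true → ¬ OnPath l v) → Avoids (triangle x) v
  triangle-avoids {x} v∉ d refl = ∑-false vanish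
    where
    vanish : ∀ l → off x l ∧ count l (edge d) ≡ false
    vanish l with off x l in o | count l (edge d) in c
    ... | false | _ = refl
    ... | true | false = refl
    ... | true | true = contradiction (proj₁ (count-vertices {l} d c)) (v∉ l o)

  -- An edge with two different ends cannot lie on a second path, so nothing cancels it in the
  -- triangle.
  triangle-edge : ∀ {x k} d → vert d ≢ vert (α d) → off x k ≡ true → count k (edge d) ≡ true →
    triangle x (edge d) ≡ true
  triangle-edge {x} {k} d nonloop o c = trans (∑-single k vanish) (cong₂ _∧_ o c)
    where
    vanish : ∀ l → l ≢ k → off x l ∧ count l (edge d) ≡ false
    vanish l l≢k with count l (edge d) in c′
    ... | false = ∧-zeroʳ (off x l)
    ... | true = let u , v = count-vertices {l} d c′ ; u′ , v′ = count-vertices {k} d c in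
      contradiction (shared-vertex l≢k u u′ v v′) nonloop

  branch-avoids : ∀ x → Avoids (triangle x) (branch x)
  branch-avoids x = triangle-avoids {x} λ l o on → contradiction (trans (sym o) (cong not (branch-OnPath on))) λ ()

  -- Path `k` is not part of the triangle opposite to its end `src k`, and its inner vertices are on
  -- no other path.
  inner-avoids : ∀ {k v} → v ∈ inner k → Avoids (triangle (src k)) v
  inner-avoids {k} v∈k = triangle-avoids {src k} λ l o on →
    contradiction (trans (sym o) (cong not (subst (λ l → end? (src k) l ≡ true) (inner-OnPath v∈k on) (src-end k)))) λ ()

  -- A filling and its complement have the same boundary. The one that is `false` at one face of the
  -- branch vertex is `false` all around it, because the triangle avoids that vertex.
  region-data : ∀ x → ∃ λ g → Bounds g (triangle x) × Clear g (branch x)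
  region-data x = g , g-bounds , g-clear
    where
    dₓ = proj₁ (vert-surj (branch x))
    vdₓ = proj₂ (vert-surj (branch x))
    filling = cycle-bounds (triangle x) (triangle-cycle x) (face dₓ)
    g₀ = proj₁ filling
    bounds = proj₂ filling
    g : Fin nF → Bool
    g f = g₀ f xor g₀ (face dₓ)
    open xor-∧-Solver
    shift : ∀ a b c → (a xor c) xor (b xor c) ≡ a xor b
    shift = solve 3 (λ a b c → (a :+ c) :+ (b :+ c) := a :+ b) refl
    g-bounds : Bounds g (triangle x)
    g-bounds d = trans (shift (g₀ (face d)) (g₀ (face (α d))) (g₀ (face dₓ))) (bounds d)
    g-clear : Clear g (branch x)
    g-clear d vd = trans
      (cong (_xor g₀ (face dₓ)) (constant-around {g₀} {triangle x} bounds (branch-avoids x) d dₓ vd vdₓ))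
      (xor-same (g₀ (face dₓ)))

  region : Fin 4 → Fin nF → Bool
  region x = proj₁ (region-data x)

  region-bounds : ∀ x → Bounds (region x) (triangle x)
  region-bounds x = proj₁ (proj₂ (region-data x))

  region-clear : ∀ x → Clear (region x) (branch x)
  region-clear x = proj₂ (proj₂ (region-data x))

  -- Consecutive vertices share a face, and `g` is constant around every vertex that `z` avoids.
  clear-chain : ∀ {g z} → Bounds g z → ∀ a xs b → Chain (Adj M) a xs b → Clear g a →
    (∀ {v} → v ∈ xs → Avoids z v) → ∀ {v} → v ∈ xs → Clear g v
  clear-chain {g} {z} bounds a (x ∷ xs) b ((d , refl , refl) , c) clear avoids = λ
    { (here refl) → clear-x ; (there v∈xs) → clear-chain {g} {z} bounds x xs b c clear-x (avoids ∘ there) v∈xs }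
    where
    clear-x : Clear g x
    clear-x d′ vd′≡x = begin
      g (face d′)      ≡⟨ constant-around {g} {z} bounds (avoids (here refl)) d′ (α d) vd′≡x refl ⟩
      g (face (α d))   ≡⟨ cong g (face-σ d) ⟨
      g (face (σ d))   ≡⟨ clear (σ d) (vert-σ d) ⟩
      false            ∎

  path-clear : ∀ {k v} → OnPath k v → ∃ λ x → end? x k ≡ true × Clear (region x) v
  path-clear (inj₁ (x , xk , refl)) = x , xk , region-clear x
  path-clear {k} (inj₂ v∈k) = src k , src-end k ,
    clear-chain {region (src k)} {triangle (src k)} (region-bounds (src k))
      _ (inner k) _ (is-path k) (region-clear (src k)) inner-avoids v∈k

  -- The region of a suitable end `x` of path `l` is clear at `v`, while path `k` belongs to its
  -- boundary triangle, `x` not being an end of `k`.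
  path-separated : ∀ {k l v} d → (∀ x → end? x l ≡ true → off x k ≡ true) → OnPath l v →
    vert d ≢ vert (α d) → count k (edge d) ≡ true → Separated v d
  path-separated {k} d l-off on nonloop c = let x , xl , clear = path-clear on in
    clear-separated {region x} {triangle x} (region-bounds x) clear d (triangle-edge {x} {k} d nonloop (l-off x xl) c)

  opposite-noncrossing : ∀ k d d′ → count k (edge d) ≡ true → count (opposite k) (edge d′) ≡ true →
    cross d d′ ≡ false
  opposite-noncrossing k d d′ c c′ with vert d ≟ vert (α d) | vert d′ ≟ vert (α d′)
  -- A loop is drawn as a point and crosses nothing.
  ... | yes loop | _ = cross-loopˡ {d} {d′} loop
  ... | no _ | yes loop = cross-loopʳ {d} {d′} loop
  ... | no nonloop | no nonloop′ =
    let u , v = count-vertices {k} d c ; u′ , v′ = count-vertices {opposite k} d′ c′ in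
    cross-separated {d} {d′}
      (path-separated {opposite k} d′ (λ x → end-off-opposite x k) u nonloop′ c′)
      (path-separated {opposite k} d′ (λ x → end-off-opposite x k) v nonloop′ c′)
      (path-separated {k} d (λ x → end-opposite-off x k) u′ nonloop c)
      (path-separated {k} d (λ x → end-opposite-off x k) v′ nonloop c)

  ρ : Fin 4 → Fin 6 → Bool
  ρ x k = ⨁ (ray (branch x)) (pathDarts k)

  ℓ : Fin 4 → Fin 4 → Bool
  ℓ x y = lt 1F (branch x) (branch y)

  triangle-ray : ∀ x → off x ∙ ρ x ≡ false
  triangle-ray x = trans (sym (triangle-∙ x (ray (branch x)) (ray-α (branch x))))
    (winding {region x} {triangle x} (region-bounds x) (region-clear x))

  -- The contributions of inner vertices cancel between consecutive darts of either path, leaving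
  -- only the ends of the two paths.
  crossings≡⨁cross : ∀ k → crossings ρ ℓ k ≡ ⨁ (λ d → ⨁ (cross d) (pathDarts (opposite k))) (pathDarts k)
  crossings≡⨁cross k = sym (begin
    ⨁ (λ d → ⨁ (cross d) ds′) ds
      ≡⟨ ⨁-cong inner-sum ds ⟩
    ⨁ (λ d → (over (vert d) xor over (vert (α d))) xor (ray c d xor ray c′ d)) ds
      ≡⟨ ⨁-xor _ _ ds ⟩
    ⨁ (λ d → over (vert d) xor over (vert (α d))) ds xor ⨁ (λ d → ray c d xor ray c′ d) ds
      ≡⟨ cong₂ _xor_ (telescope over _ (inner k) _ (is-path k)) (⨁-xor (ray c) (ray c′) ds) ⟩
    crossings ρ ℓ k ∎)
    where
    k′ = opposite k
    ds = pathDarts k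
    ds′ = pathDarts k′
    c = branch (src k′)
    c′ = branch (tgt k′)
    over : Fin nV → Bool
    over u = ⨁ (ray u) ds′ xor (lt 1F u c xor lt 1F u c′)
    drop-sum : ∀ u → ⨁ (λ d′ → drop d′ u) ds′ ≡ over u
    drop-sum u = trans (⨁-xor (ray u) _ ds′)
      (cong (⨁ (ray u) ds′ xor_) (telescope (lt 1F u) _ (inner k′) _ (is-path k′)))
    inner-sum : ∀ d → ⨁ (cross d) ds′ ≡ (over (vert d) xor over (vert (α d))) xor (ray c d xor ray c′ d)
    inner-sum d = trans (⨁-xor _ _ ds′) (cong₂ _xor_
      (trans (⨁-xor _ _ ds′) (cong₂ _xor_ (drop-sum (vert d)) (drop-sum (vert (α d)))))
      (telescope (λ v → ray v d) _ (inner k′) _ (is-path k′)))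

  -- Regrouped by edges, the double sum only retains pairs of edges of odd multiplicity on the two
  -- paths, and these cross evenly.
  crossings≡0 : ∀ k → crossings ρ ℓ k ≡ false
  crossings≡0 k = begin
    crossings ρ ℓ k
      ≡⟨ crossings≡⨁cross k ⟩
    ⨁ (λ d → ⨁ (cross d) ds′) ds
      ≡⟨ count-∙ k _ (λ d → ⨁-cong (cross-αˡ d) ds′) ⟨
    count k ∙ (λ e → ⨁ (cross (dart e)) ds′)
      ≡⟨ ∑-cong (λ e → cong (count k e ∧_) (count-∙ (opposite k) (cross (dart e)) (cross-αʳ (dart e)))) ⟨
    count k ∙ (λ e → count (opposite k) ∙ (λ e′ → cross (dart e) (dart e′)))
      ≡⟨ ∑-false vanish ⟩
    false ∎
    where
    ds = pathDarts k
    ds′ = pathDarts (opposite k)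
    vanish : ∀ e → count k e ∧ count (opposite k) ∙ (λ e′ → cross (dart e) (dart e′)) ≡ false
    vanish e with count k e in c
    ... | false = refl
    ... | true = ∑-false vanish′
      where
      vanish′ : ∀ e′ → count (opposite k) e′ ∧ cross (dart e) (dart e′) ≡ false
      vanish′ e′ with count (opposite k) e′ in c′
      ... | false = refl
      ... | true = opposite-noncrossing k (dart e) (dart e′)
                     (trans (cong (count k) (edge-dart e)) c) (trans (cong (count (opposite k)) (edge-dart e′)) c′)

  impossible : ⊥
  impossible = radon ρ ℓ (λ x y x≢y → lt-not 1F (x≢y ∘ branch-inj)) triangle-ray crossings≡0

theorem2p1 : (M : PlaneMap) → IsPlane M → K4Subdivision M → ¬ DimAtMost (PVF M) 3
theorem2p1 M plane S (L , L-injective , L-realizes) = K4.impossible M plane S L L-injective L-realizes
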